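{- Let $R$ be a discrete valuation ring with maximal ideal $\mathfrak{m}_R$ and let $K$ be a field of fractions of $R$. Then the $\mathfrak{m}_R$-adic valuation $v_{\mathfrak{m}_R} : K \to \mathbb{Z}_{\mathrm{m}0}$ is discrete.
   Context: $\mathbb{Z}_{\mathrm{m}0}$ is the linearly ordered commutative group with zero obtained from the multiplicatively written ordered group $\mathbb{Z}$ (elements $\mathrm{of\_add}(n)$, $n\in\mathbb{Z}$, with $\mathrm{of\_add}(a+b)=\mathrm{of\_add}(a)\,\mathrm{of\_add}(b)$, ordered as $\mathbb{Z}$) by adjoining an absorbing smallest element $0$. A valuation on a commutative unitary ring $A$ is a function $v: A\to \mathbb{Z}_{\mathrm{m}0}$ with $v(0)=0$, $v(1)=1$, $v(xy)=v(x)v(y)$ and $v(x+y)\le\max\{v(x),v(y)\}$ for all $x,y$. It is called discrete if it is surjective onto $\mathbb{Z}_{\mathrm{m}0}$. For a maximal ideal $\mathfrak{m}$ of a Dedekind domain $R$ which is not a field, with fraction field $K$, the $\mathfrak{m}$-adic valuation $v_{\mathfrak{m}}: K\to\mathbb{Z}_{\mathrm{m}0}$ is defined by $v_{\mathfrak m}(0)=0$ and $v_{\mathfrak m}(r/s)=\mathrm{of\_add}(-(a(r)-a(s)))$ for nonzero $r,s\in R$, where $a(r)$ is the exponent of $\mathfrak{m}$ in the factorization of the principal ideal $(r)$ into maximal ideals. A discrete valuation ring is a local principal ideal domain that is not a field (so in particular a Dedekind domain). -}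

module Defs where

open import Algebra.Bundles using (CommutativeRing)
open import Algebra.Morphism.Structures using (module RingMorphisms)
import Algebra.Construct.NaturalChoice.Max as NaturalMax
import Algebra.Properties.CommutativeSemigroup as CommSemigroupProps
import Algebra.Properties.CommutativeSemigroup.Divisibility as CommDivisibility
import Algebra.Properties.Monoid.Divisibility as MonoidDivisibility
import Algebra.Properties.Ring as RingProps
import Algebra.Properties.Semiring.Exp as Exp
open import Data.Empty using (⊥-elim)
open import Data.Integer.Base as ℤ using (ℤ; +_)
import Data.Integer.Properties as ℤ
open import Data.List.Base using (List; []; _∷_; foldr; replicate)
open import Data.List.Relation.Unary.All using (All; []; _∷_)
import Data.List.Relation.Unary.All.Properties as All
open import Data.Nat.Base as ℕ using (ℕ; zero; suc)
import Data.Nat.Properties as ℕ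
open import Data.Product.Base using (∃; ∃₂; _×_; _,_; proj₁; proj₂; swap)
open import Data.Sum.Base using (_⊎_; inj₁; inj₂)
open import Function.Definitions using (Surjective)
open import Level using (Level; _⊔_; Lift; lift; lower; 0ℓ)
  renaming (suc to lsuc)
open import Relation.Binary.Bundles using (TotalOrder)
open import Relation.Binary.Construct.Add.Infimum.NonStrict ℤ._≤_
  using (_≤₋_; ≤₋-isTotalOrder-≡)
open import Relation.Binary.PropositionalEquality as ≡ using (_≡_)
import Relation.Binary.Reasoning.Setoid as SetoidReasoning
open import Relation.Nullary using (¬_; Dec; yes; no)
open import Relation.Nullary.Construct.Add.Infimum using (_₋; ⊥₋; [_])
open import Relation.Nullary.Decidable using (map′)
open import Relation.Unary using (Pred; _∈_; _⊆_; _≐_)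
open import Relation.Unary.Properties using (≐-sym; ≐-trans)

------------------------------------------------------------------------
-- The ordered group with zero ℤₘ₀

-- The carrier is written additively on ℤ, so multiplication in ℤₘ₀ is
-- addition of integers and the unit is of-add 0.
ℤₘ₀ : Set
ℤₘ₀ = ℤ ₋

of-add : ℤ → ℤₘ₀
of-add = [_]

0ₘ : ℤₘ₀
0ₘ = ⊥₋

1ₘ : ℤₘ₀
1ₘ = of-add (+ 0)

infixl 7 _·ₘ_

_·ₘ_ : ℤₘ₀ → ℤₘ₀ → ℤₘ₀
⊥₋    ·ₘ _     = ⊥₋
[ _ ] ·ₘ ⊥₋    = ⊥₋
[ a ] ·ₘ [ b ] = [ a ℤ.+ b ]

infix 4 _≤ₘ_

_≤ₘ_ : ℤₘ₀ → ℤₘ₀ → Set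
_≤ₘ_ = _≤₋_

ℤₘ₀-totalOrder : TotalOrder 0ℓ 0ℓ 0ℓ
ℤₘ₀-totalOrder = record
  { Carrier      = ℤₘ₀
  ; _≈_          = _≡_
  ; _≤_          = _≤ₘ_
  ; isTotalOrder = ≤₋-isTotalOrder-≡ ℤ.≤-isTotalOrder
  }

maxₘ : ℤₘ₀ → ℤₘ₀ → ℤₘ₀
maxₘ = NaturalMax._⊔_ ℤₘ₀-totalOrder

------------------------------------------------------------------------
-- Valuations

module _ {a ℓ} (A : CommutativeRing a ℓ) where
  open CommutativeRing A

  record IsValuation (v : Carrier → ℤₘ₀) : Set (a ⊔ ℓ) where
    field
      cong   : ∀ {x y} → x ≈ y → v x ≡ v y
      map-0  : v 0# ≡ 0ₘ
      map-1  : v 1# ≡ 1ₘ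
      map-*  : ∀ x y → v (x * y) ≡ v x ·ₘ v y
      map-+  : ∀ x y → v (x + y) ≤ₘ maxₘ (v x) (v y)

  record IsDiscreteValuation (v : Carrier → ℤₘ₀) : Set (a ⊔ ℓ) where
    field
      isValuation : IsValuation v
      surjective  : Surjective _≈_ _≡_ v

------------------------------------------------------------------------
-- Ideals and classes of commutative rings

module _ {c ℓ} (R : CommutativeRing c ℓ) where
  open CommutativeRing R
  open MonoidDivisibility *-monoid using (_∣_; _,_; ∣ʳ-trans; ∣ʳ-refl; ∣ʳ-reflexive)
  open CommDivisibility *-commutativeSemigroup using (x∣y⇒zx∣zy; ∙-cong-∣)

  record Ideal : Set (lsuc (c ⊔ ℓ)) where
    field
      ⟪_⟫      : Pred Carrier (c ⊔ ℓ)
      resp     : ∀ {x y} → x ≈ y → x ∈ ⟪_⟫ → y ∈ ⟪_⟫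
      0∈       : 0# ∈ ⟪_⟫
      +-closed : ∀ {x y} → x ∈ ⟪_⟫ → y ∈ ⟪_⟫ → x + y ∈ ⟪_⟫
      *-closed : ∀ r {x} → x ∈ ⟪_⟫ → r * x ∈ ⟪_⟫

  open Ideal public using (⟪_⟫)

  principal : Carrier → Ideal
  principal r = record
    { ⟪_⟫      = λ x → r ∣ x
    ; resp     = λ x≈y r∣x → ∣ʳ-trans r∣x (∣ʳ-reflexive x≈y)
    ; 0∈       = 0# , zeroˡ r
    ; +-closed = λ { (p , pr≈x) (q , qr≈y) → p + q , trans (distribʳ r p q) (+-cong pr≈x qr≈y) }
    ; *-closed = λ { s (p , pr≈x) → s * p , trans (*-assoc s p r) (*-congˡ pr≈x) }
    }

  -- Finite sums of products x * y with x ∈ I and y ∈ J.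
  data ProductPred (I J : Ideal) : Pred Carrier (c ⊔ ℓ) where
    nil  : ∀ {z} → 0# ≈ z → ProductPred I J z
    cons : ∀ {x y z t} → x ∈ ⟪ I ⟫ → y ∈ ⟪ J ⟫ → ProductPred I J z →
           x * y + z ≈ t → ProductPred I J t

  infixr 7 _·ᴵ_

  _·ᴵ_ : Ideal → Ideal → Ideal
  I ·ᴵ J = record
    { ⟪_⟫      = ProductPred I J
    ; resp     = resp′
    ; 0∈       = nil refl
    ; +-closed = +-closed′
    ; *-closed = *-closed′
    }
    where
    resp′ : ∀ {x y} → x ≈ y → ProductPred I J x → ProductPred I J y
    resp′ x≈y (nil 0≈x)       = nil (trans 0≈x x≈y)
    resp′ x≈y (cons i j p eq) = cons i j p (trans eq x≈y)

    +-closed′ : ∀ {x y} → ProductPred I J x → ProductPred I J y → ProductPred I J (x + y)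
    +-closed′ (nil 0≈x)       q = resp′ (trans (sym (+-identityˡ _)) (+-congʳ 0≈x)) q
    +-closed′ (cons i j p eq) q =
      cons i j (+-closed′ p q) (trans (sym (+-assoc _ _ _)) (+-congʳ eq))

    *-closed′ : ∀ r {x} → ProductPred I J x → ProductPred I J (r * x)
    *-closed′ r (nil 0≈x)       = nil (trans (sym (zeroʳ r)) (*-congˡ 0≈x))
    *-closed′ r (cons i j p eq) =
      cons (Ideal.*-closed I r i) j (*-closed′ r p)
        (trans (trans (+-congʳ (*-assoc r _ _)) (sym (distribˡ r _ _))) (*-congˡ eq))

  product : List Ideal → Ideal
  product = foldr _·ᴵ_ (principal 1#)

  record IsMaximal (I : Ideal) : Set (lsuc (c ⊔ ℓ)) where
    field
      proper  : ¬ (1# ∈ ⟪ I ⟫)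
      maximal : ∀ J → ⟪ I ⟫ ⊆ ⟪ J ⟫ → ¬ (1# ∈ ⟪ J ⟫) → ⟪ J ⟫ ⊆ ⟪ I ⟫

  -- Occurs I Js n: exactly n entries of the list Js are equal to I as ideals.
  data Occurs (I : Ideal) : List Ideal → ℕ → Set (lsuc (c ⊔ ℓ)) where
    none : Occurs I [] 0
    here : ∀ {J Js n} → ⟪ I ⟫ ≐ ⟪ J ⟫ → Occurs I Js n → Occurs I (J ∷ Js) (suc n)
    skip : ∀ {J Js n} → ¬ (⟪ I ⟫ ≐ ⟪ J ⟫) → Occurs I Js n → Occurs I (J ∷ Js) n

  -- n is the exponent of 𝔪 in a factorization of (r) into maximal ideals.
  record IsExponent (𝔪 : Ideal) (r : Carrier) (n : ℕ) : Set (lsuc (c ⊔ ℓ)) where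
    field
      factors       : List Ideal
      maximal       : All IsMaximal factors
      factorization : ⟪ principal r ⟫ ≐ ⟪ product factors ⟫
      occurs        : Occurs 𝔪 factors n

  record IsIntegralDomain : Set (c ⊔ ℓ) where
    field
      1≉0           : ¬ (1# ≈ 0#)
      noZeroDivisor : ∀ {x y} → x * y ≈ 0# → x ≈ 0# ⊎ y ≈ 0#

  record IsField : Set (c ⊔ ℓ) where
    field
      1≉0     : ¬ (1# ≈ 0#)
      inverse : ∀ {x} → ¬ (x ≈ 0#) → ∃ λ y → x * y ≈ 1#

  -- Ideals are arbitrary predicates, so exhibiting a generator for each of
  -- them already implies excluded middle (DVR.em below); no separate
  -- classical axiom is needed to compute exponents.
  record IsPrincipalIdealDomain : Set (lsuc (c ⊔ ℓ)) where
    field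
      isIntegralDomain : IsIntegralDomain
      isPrincipal      : ∀ I → ∃ λ g → ⟪ I ⟫ ≐ ⟪ principal g ⟫

    open IsIntegralDomain isIntegralDomain public

  record IsLocal : Set (lsuc (c ⊔ ℓ)) where
    field
      𝔪           : Ideal
      𝔪-isMaximal : IsMaximal 𝔪
      𝔪-unique    : ∀ I → IsMaximal I → ⟪ I ⟫ ≐ ⟪ 𝔪 ⟫

  record IsDiscreteValuationRing : Set (lsuc (c ⊔ ℓ)) where
    field
      isPID    : IsPrincipalIdealDomain
      isLocal  : IsLocal
      notField : ¬ IsField

    open IsPrincipalIdealDomain isPID public
    open IsLocal isLocal public

------------------------------------------------------------------------
-- Fields of fractions and adic valuations

record FractionField {c ℓ} (R : CommutativeRing c ℓ) (k ℓk : Level)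
  : Set (c ⊔ ℓ ⊔ lsuc (k ⊔ ℓk)) where
  private module R = CommutativeRing R
  field
    K : CommutativeRing k ℓk

  open CommutativeRing K
  open RingMorphisms R.rawRing rawRing using (IsRingMonomorphism)

  field
    isField            : IsField K
    ι                  : R.Carrier → Carrier
    isRingMonomorphism : IsRingMonomorphism ι
    fraction           : ∀ x → ∃₂ λ r s → ¬ (s R.≈ R.0#) × x * ι s ≈ ι r

module _ {c ℓ k ℓk} (R : CommutativeRing c ℓ) (F : FractionField R k ℓk) where
  open FractionField F
  private
    module R = CommutativeRing R
    module K = CommutativeRing K

  -- This characterizes v uniquely as soon as exponents exist, in
  -- particular over any Dedekind domain.  The equation x = r/s is written
  -- x * ι s ≈ ι r.
  record IsAdicValuation (𝔪 : Ideal R) (v : K.Carrier → ℤₘ₀) : Set (lsuc (c ⊔ ℓ) ⊔ k ⊔ ℓk) where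
    field
      cong  : ∀ {x y} → x K.≈ y → v x ≡ v y
      map-0 : v K.0# ≡ 0ₘ
      map-/ : ∀ {r s a b x} → ¬ (r R.≈ R.0#) → ¬ (s R.≈ R.0#) →
              IsExponent R 𝔪 r a → IsExponent R 𝔪 s b →
              x K.* ι s K.≈ ι r → v x ≡ of-add (ℤ.- (+ a ℤ.- + b))

------------------------------------------------------------------------
-- Exponents in a discrete valuation ring

module DVR {c ℓ} (R : CommutativeRing c ℓ) (D : IsDiscreteValuationRing R) where
  open CommutativeRing R
  open IsDiscreteValuationRing D
  open MonoidDivisibility *-monoid using (_∣_; _,_; ∣ʳ-trans; ∣ʳ-refl; ∣ʳ-reflexive)
  open CommDivisibility *-commutativeSemigroup using (x∣y⇒zx∣zy; ∙-cong-∣)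
  open CommSemigroupProps *-commutativeSemigroup using (x∙yz≈y∙xz)
  open Exp semiring using (_^_; ^-homo-*)
  open RingProps ring using (x∙y⁻¹≈ε⇒x≈y; [y-z]x≈yx-zx)

  abstract
    -- The ideal { x ∣ x = 0 or P } has a generator, which is 0 iff P fails.
    em : ∀ {P : Set (c ⊔ ℓ)} → Dec P
    em {P} = decide (isPrincipal I)
      where
      +-closed′ : ∀ {x y} → x ≈ 0# ⊎ P → y ≈ 0# ⊎ P → x + y ≈ 0# ⊎ P
      +-closed′ (inj₁ x≈0) (inj₁ y≈0) = inj₁ (trans (+-cong x≈0 y≈0) (+-identityˡ 0#))
      +-closed′ (inj₁ _)   (inj₂ h)   = inj₂ h
      +-closed′ (inj₂ h)   _          = inj₂ h

      *-closed′ : ∀ r {x} → x ≈ 0# ⊎ P → r * x ≈ 0# ⊎ P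
      *-closed′ r (inj₁ x≈0) = inj₁ (trans (*-congˡ x≈0) (zeroʳ r))
      *-closed′ r (inj₂ h)   = inj₂ h

      resp′ : ∀ {x y} → x ≈ y → x ≈ 0# ⊎ P → y ≈ 0# ⊎ P
      resp′ x≈y (inj₁ x≈0) = inj₁ (trans (sym x≈y) x≈0)
      resp′ x≈y (inj₂ h)   = inj₂ h

      I : Ideal R
      I = record
        { ⟪_⟫      = λ x → x ≈ 0# ⊎ P
        ; resp     = resp′
        ; 0∈       = inj₁ refl
        ; +-closed = +-closed′
        ; *-closed = *-closed′
        }

      decide : (∃ λ g → ⟪ I ⟫ ≐ (g ∣_)) → Dec P
      decide (g , I⊆g , g⊆I) with g⊆I (∣ʳ-refl {g})
      ... | inj₂ h   = yes h
      ... | inj₁ g≈0 = no absurd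
        where
        absurd : ¬ P
        absurd h with I⊆g {1#} (inj₂ h)
        ... | q , qg≈1 = 1≉0 (trans (sym qg≈1) (trans (*-congˡ g≈0) (zeroʳ q)))

  ≈0? : ∀ x → Dec (x ≈ 0#)
  ≈0? x = map′ lower lift (em {Lift c (x ≈ 0#)})

  cancelʳ : ∀ {x y z} → ¬ (x ≈ 0#) → y * x ≈ z * x → y ≈ z
  cancelʳ {x} {y} {z} x≉0 eq with noZeroDivisor
    (trans ([y-z]x≈yx-zx x y z) (trans (+-congʳ eq) (-‿inverseʳ (z * x))))
  ... | inj₁ y-z≈0 = x∙y⁻¹≈ε⇒x≈y y z y-z≈0
  ... | inj₂ x≈0   = ⊥-elim (x≉0 x≈0)

  chain : (f : ℕ → Carrier) → (∀ n → f (suc n) ∣ f n) → ¬ (∀ n → ¬ (f n ∣ f (suc n)))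
  chain f dec strict = absurd (isPrincipal U)
    where
    down : ∀ m n → f (m ℕ.+ n) ∣ f n
    down zero    n = ∣ʳ-refl
    down (suc m) n = ∣ʳ-trans (dec (m ℕ.+ n)) (down m n)

    U : Ideal R
    U = record
      { ⟪_⟫      = λ x → ∃ λ n → f n ∣ x
      ; resp     = λ { x≈y (n , d) → n , Ideal.resp (principal R (f n)) x≈y d }
      ; 0∈       = 0 , Ideal.0∈ (principal R (f 0))
      ; +-closed = λ { (m , d) (n , e) → m ℕ.+ n ,
          Ideal.+-closed (principal R (f (m ℕ.+ n)))
            (∣ʳ-trans (≡.subst (λ i → f i ∣ f m) (ℕ.+-comm n m) (down n m)) d)
            (∣ʳ-trans (down m n) e) }
      ; *-closed = λ { r (n , d) → n , Ideal.*-closed (principal R (f n)) r d }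
      }

    absurd : ¬ (∃ λ g → ⟪ U ⟫ ≐ (g ∣_))
    absurd (g , U⊆g , g⊆U) with g⊆U (∣ʳ-refl {g})
    ... | n , fn∣g = strict n (∣ʳ-trans fn∣g (U⊆g (suc n , ∣ʳ-refl)))

  noDescent : ∀ {a} (S : Carrier → Set a) →
              (∀ {x} → S x → ∃ λ y → S y × y ∣ x × ¬ (x ∣ y)) → ∀ {x} → ¬ S x
  noDescent S step {x} Sx = chain
    (λ n → proj₁ (seq n))
    (λ n → proj₁ (proj₂ (proj₂ (step (proj₂ (seq n))))))
    (λ n → proj₂ (proj₂ (proj₂ (step (proj₂ (seq n))))))
    where
    seq : ℕ → ∃ S
    seq zero    = x , Sx
    seq (suc n) with step (proj₂ (seq n))
    ... | y , Sy , _ = y , Sy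

  p : Carrier
  p = proj₁ (isPrincipal 𝔪)

  𝔪≐p : ⟪ 𝔪 ⟫ ≐ (p ∣_)
  𝔪≐p = proj₂ (isPrincipal 𝔪)

  p∤1 : ¬ (p ∣ 1#)
  p∤1 p∣1 = IsMaximal.proper 𝔪-isMaximal (proj₂ 𝔪≐p p∣1)

  p≉0 : ¬ (p ≈ 0#)
  p≉0 p≈0 = notField (record { 1≉0 = 1≉0 ; inverse = inverse })
    where
    inverse : ∀ {x} → ¬ (x ≈ 0#) → ∃ λ y → x * y ≈ 1#
    inverse {x} x≉0 with em {x ∣ 1#}
    ... | yes (y , yx≈1) = y , trans (*-comm x y) yx≈1
    ... | no x∤1 = ⊥-elim (x≉0 (x≈0 (proj₁ 𝔪≐p
            (IsMaximal.maximal 𝔪-isMaximal (principal R x) 𝔪⊆x x∤1 ∣ʳ-refl))))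
      where
      zero-multiple : ∀ {y} → p ∣ y → y ≈ 0#
      zero-multiple (q , qp≈y) = trans (sym qp≈y) (trans (*-congˡ p≈0) (zeroʳ q))

      x≈0 : p ∣ x → x ≈ 0#
      x≈0 = zero-multiple

      𝔪⊆x : ⟪ 𝔪 ⟫ ⊆ (x ∣_)
      𝔪⊆x y∈𝔪 = 0# , trans (zeroˡ x) (sym (zero-multiple (proj₁ 𝔪≐p y∈𝔪)))

  nonunit⇒p∣ : ∀ {r} → ¬ (r ∣ 1#) → p ∣ r
  nonunit⇒p∣ {r} r∤1 with em {∃ λ d → d ∣ r × ¬ (d ∣ 1#) × ¬ (∃ λ e → e ∣ d × ¬ (e ∣ 1#) × ¬ (d ∣ e))}
  ... | yes (d , d∣r , d∤1 , d-max) = proj₁ 𝔪≐p (proj₁ (𝔪-unique (principal R d) d-isMaximal) d∣r)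
    where
    below : ∀ J → (d ∣_) ⊆ ⟪ J ⟫ → ¬ (1# ∈ ⟪ J ⟫) → ⟪ J ⟫ ⊆ (d ∣_)
    below J d⊆J J-proper x∈J with isPrincipal J
    ... | e , J⊆e , e⊆J with em {d ∣ e}
    ...   | yes d∣e = ∣ʳ-trans d∣e (J⊆e x∈J)
    ...   | no d∤e  = ⊥-elim (d-max (e , J⊆e (d⊆J ∣ʳ-refl) , (λ e∣1 → J-proper (e⊆J e∣1)) , d∤e))

    d-isMaximal : IsMaximal R (principal R d)
    d-isMaximal = record { proper = d∤1 ; maximal = below }
  ... | no none-maximal = ⊥-elim (noDescent (λ d → d ∣ r × ¬ (d ∣ 1#)) step (∣ʳ-refl , r∤1))
    where
    step : ∀ {d} → d ∣ r × ¬ (d ∣ 1#) → ∃ λ e → (e ∣ r × ¬ (e ∣ 1#)) × e ∣ d × ¬ (d ∣ e)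
    step {d} (d∣r , d∤1) with em {∃ λ e → e ∣ d × ¬ (e ∣ 1#) × ¬ (d ∣ e)}
    ... | yes (e , e∣d , e∤1 , d∤e) = e , (∣ʳ-trans e∣d d∣r , e∤1) , e∣d , d∤e
    ... | no d-max = ⊥-elim (none-maximal (d , d∣r , d∤1 , d-max))

  record Assoc (r : Carrier) (n : ℕ) : Set (c ⊔ ℓ) where
    constructor _⇄_
    field
      r∣pⁿ : r ∣ p ^ n
      pⁿ∣r : p ^ n ∣ r

  decompose : ∀ {r} → ¬ (r ≈ 0#) → ∃ λ n → Assoc r n
  decompose {r} r≉0 with em {∃ λ n → Assoc r n}
  ... | yes h = h
  ... | no ¬h = ⊥-elim (noDescent (λ s → ¬ (s ≈ 0#) × ¬ (∃ λ n → Assoc s n)) step (r≉0 , ¬h))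
    where
    step : ∀ {s} → ¬ (s ≈ 0#) × ¬ (∃ λ n → Assoc s n) →
           ∃ λ q → (¬ (q ≈ 0#) × ¬ (∃ λ n → Assoc q n)) × q ∣ s × ¬ (s ∣ q)
    step {s} (s≉0 , ¬assoc) with nonunit⇒p∣ {s} (λ s∣1 → ¬assoc (0 , (s∣1 ⇄ (s , *-identityʳ s))))
    ... | q , qp≈s = q , (q≉0 , ¬assoc′) , (p , trans (*-comm p q) qp≈s) , s∤q
      where
      pq≈s : p * q ≈ s
      pq≈s = trans (*-comm p q) qp≈s

      q≉0 : ¬ (q ≈ 0#)
      q≉0 q≈0 = s≉0 (trans (sym pq≈s) (trans (*-congˡ q≈0) (zeroʳ p)))

      ¬assoc′ : ¬ (∃ λ n → Assoc q n)
      ¬assoc′ (n , (q∣pⁿ ⇄ pⁿ∣q)) = ¬assoc (suc n ,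
        (∣ʳ-trans (∣ʳ-reflexive (sym pq≈s)) (x∣y⇒zx∣zy p q∣pⁿ) ⇄
         ∣ʳ-trans (x∣y⇒zx∣zy p pⁿ∣q) (∣ʳ-reflexive pq≈s)))

      s∤q : ¬ (s ∣ q)
      s∤q (t , ts≈q) = p∤1 (t , cancelʳ q≉0
        (trans (*-assoc t p q) (trans (*-congˡ pq≈s) (trans ts≈q (sym (*-identityˡ q))))))

  p^-injective : ∀ a b → p ^ a ∣ p ^ b → a ℕ.≤ b
  p^-injective zero    b       _ = ℕ.z≤n
  p^-injective (suc a) zero    d = ⊥-elim (p∤1 (∣ʳ-trans (p ^ a , *-comm (p ^ a) p) d))
  p^-injective (suc a) (suc b) (q , eq) = ℕ.s≤s (p^-injective a b (q , cancelʳ p≉0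
    (trans (*-assoc q (p ^ a) p) (trans (*-congˡ (*-comm (p ^ a) p)) (trans eq (*-comm p (p ^ b)))))))

  Assoc-unique : ∀ {r a b} → Assoc r a → Assoc r b → a ≡ b
  Assoc-unique {a = a} {b} (r∣pᵃ ⇄ pᵃ∣r) (r∣pᵇ ⇄ pᵇ∣r) = ℕ.≤-antisym
    (p^-injective a b (∣ʳ-trans pᵃ∣r r∣pᵇ)) (p^-injective b a (∣ʳ-trans pᵇ∣r r∣pᵃ))

  Assoc-* : ∀ {r s a b} → Assoc r a → Assoc s b → Assoc (r * s) (a ℕ.+ b)
  Assoc-* {a = a} {b} (r∣pᵃ ⇄ pᵃ∣r) (s∣pᵇ ⇄ pᵇ∣s) =
    ∣ʳ-trans (∙-cong-∣ r∣pᵃ s∣pᵇ) (∣ʳ-reflexive (sym (^-homo-* p a b))) ⇄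
    ∣ʳ-trans (∣ʳ-reflexive (^-homo-* p a b)) (∙-cong-∣ pᵃ∣r pᵇ∣s)

  Assoc-resp : ∀ {r s n} → r ≈ s → Assoc r n → Assoc s n
  Assoc-resp r≈s (r∣pⁿ ⇄ pⁿ∣r) =
    ∣ʳ-trans (∣ʳ-reflexive (sym r≈s)) r∣pⁿ ⇄ ∣ʳ-trans pⁿ∣r (∣ʳ-reflexive r≈s)

  ·ᴵ-principal : ∀ I J {a b} → ⟪ I ⟫ ≐ (a ∣_) → ⟪ J ⟫ ≐ (b ∣_) → ⟪ _·ᴵ_ R I J ⟫ ≐ ((a * b) ∣_)
  ·ᴵ-principal I J {a} {b} (I⊆a , a⊆I) (J⊆b , b⊆J) = to , from
    where
    module ab = Ideal (principal R (a * b))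

    to : ProductPred R I J ⊆ ((a * b) ∣_)
    to (nil 0≈x)       = ab.resp 0≈x ab.0∈
    to (cons i j h eq) = ab.resp eq (ab.+-closed (∙-cong-∣ (I⊆a i) (J⊆b j)) (to h))

    from : ((a * b) ∣_) ⊆ ProductPred R I J
    from (q , eq) = cons (a⊆I ∣ʳ-refl) (Ideal.*-closed J q (b⊆J ∣ʳ-refl)) (nil refl)
      (trans (+-identityʳ _) (trans (x∙yz≈y∙xz a q b) eq))

  product≐p^ : ∀ {Js n} → All (IsMaximal R) Js → Occurs R 𝔪 Js n → ⟪ product R Js ⟫ ≐ (p ^ n ∣_)
  product≐p^ []       none = (λ h → h) , (λ h → h)
  product≐p^ {J ∷ Js} (_ ∷ maxs) (here 𝔪≐J occ) =
    ·ᴵ-principal J (product R Js) (≐-trans (≐-sym 𝔪≐J) 𝔪≐p) (product≐p^ maxs occ)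
  product≐p^ {J ∷ _}  (max ∷ _)  (skip 𝔪≢J _)   = ⊥-elim (𝔪≢J (swap (𝔪-unique J max)))

  exponent⇒Assoc : ∀ {r n} → IsExponent R 𝔪 r n → Assoc r n
  exponent⇒Assoc {r} e = proj₂ r≐pⁿ ∣ʳ-refl ⇄ proj₁ r≐pⁿ ∣ʳ-refl
    where
    open IsExponent e
    r≐pⁿ = ≐-trans factorization (product≐p^ maximal occurs)

  abstract
    exponent-exists : ∀ {r} → ¬ (r ≈ 0#) → ∃ λ n → IsExponent R 𝔪 r n
    exponent-exists {r} r≉0 with decompose r≉0
    ... | n , (r∣pⁿ ⇄ pⁿ∣r) = n , record
      { factors       = replicate n 𝔪
      ; maximal       = maxs
      ; factorization = ≐-trans (∣ʳ-trans pⁿ∣r , ∣ʳ-trans r∣pⁿ) (≐-sym (product≐p^ maxs (occ n)))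
      ; occurs        = occ n
      }
      where
      maxs : All (IsMaximal R) (replicate n 𝔪)
      maxs = All.replicate⁺ n 𝔪-isMaximal

      occ : ∀ m → Occurs R 𝔪 (replicate m 𝔪) m
      occ zero    = none
      occ (suc m) = here ((λ h → h) , (λ h → h)) (occ m)

  exponent : ∀ {r} → ¬ (r ≈ 0#) → ℕ
  exponent r≉0 = proj₁ (exponent-exists r≉0)

  exponent-isExponent : ∀ {r} (r≉0 : ¬ (r ≈ 0#)) → IsExponent R 𝔪 r (exponent r≉0)
  exponent-isExponent r≉0 = proj₂ (exponent-exists r≉0)

------------------------------------------------------------------------
-- The adic valuation of a discrete valuation ring

module _ {c ℓ k ℓk} (R : CommutativeRing c ℓ) (D : IsDiscreteValuationRing R)
         (F : FractionField R k ℓk) where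
  open DVR R D
  open IsDiscreteValuationRing D using (𝔪; noZeroDivisor)
  open FractionField F
  private
    module R = CommutativeRing R
    module K = CommutativeRing K
  open RingMorphisms R.rawRing K.rawRing using (module IsRingMonomorphism)
  open IsRingMonomorphism isRingMonomorphism using (injective; *-homo; 0#-homo; ⟦⟧-cong)
  open CommSemigroupProps K.*-commutativeSemigroup using (xy∙z≈xz∙y)

  quotientValue : ∀ {r s} → Dec (r R.≈ R.0#) → ¬ (s R.≈ R.0#) → ℤₘ₀
  quotientValue (yes _)  _   = 0ₘ
  quotientValue (no r≉0) s≉0 =
    of-add (ℤ.- (+ exponent r≉0 ℤ.- + exponent s≉0))

  -- Computed from the representative r/s of x supplied by the field of
  -- fractions; adicValuation-isAdic shows that every other one gives the
  -- same value.
  adicValuation : K.Carrier → ℤₘ₀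
  adicValuation x with fraction x
  ... | r , s , s≉0 , _ = quotientValue {r} {s} (≈0? r) s≉0

  private
    ≈0⇒0 : ∀ {x} → x K.≈ K.0# → adicValuation x ≡ 0ₘ
    ≈0⇒0 {x} x≈0 with fraction x
    ... | r , s , s≉0 , eq with ≈0? r
    ...   | yes _  = ≡.refl
    ...   | no r≉0 = ⊥-elim (r≉0 (injective (K.trans (K.sym eq)
              (K.trans (K.*-congʳ x≈0) (K.trans (K.zeroˡ _) (K.sym 0#-homo))))))

    numerator≈0 : ∀ {x r s} → x K.* ι s K.≈ ι r → ¬ (s R.≈ R.0#) → r R.≈ R.0# → x K.≈ K.0#
    numerator≈0 {x} {r} {s} eq s≉0 r≈0
      with IsField.inverse isField {ι s} (λ ιs≈0 → s≉0 (injective (K.trans ιs≈0 (K.sym 0#-homo))))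
    ... | t , st≈1 = begin
      x                  ≈⟨ K.*-identityʳ x ⟨
      x K.* K.1#         ≈⟨ K.*-congˡ st≈1 ⟨
      x K.* (ι s K.* t)  ≈⟨ K.*-assoc x (ι s) t ⟨
      x K.* ι s K.* t    ≈⟨ K.*-congʳ eq ⟩
      ι r K.* t          ≈⟨ K.*-congʳ (K.trans (⟦⟧-cong r≈0) 0#-homo) ⟩
      K.0# K.* t         ≈⟨ K.zeroˡ t ⟩
      K.0#               ∎
      where open SetoidReasoning K.setoid

    cross : ∀ {x r s r′ s′} → x K.* ι s K.≈ ι r → x K.* ι s′ K.≈ ι r′ → r R.* s′ R.≈ r′ R.* s
    cross {x} {r} {s} {r′} {s′} eq eq′ = injective (begin
      ι (r R.* s′)         ≈⟨ *-homo r s′ ⟩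
      ι r K.* ι s′         ≈⟨ K.*-congʳ eq ⟨
      x K.* ι s K.* ι s′   ≈⟨ xy∙z≈xz∙y x (ι s) (ι s′) ⟩
      x K.* ι s′ K.* ι s   ≈⟨ K.*-congʳ eq′ ⟩
      ι r′ K.* ι s         ≈⟨ *-homo r′ s ⟨
      ι (r′ R.* s)         ∎)
      where open SetoidReasoning K.setoid

    difference : ∀ a b a′ b′ → a ℕ.+ b′ ≡ a′ ℕ.+ b → + a ℤ.- + b ≡ + a′ ℤ.- + b′
    difference a b a′ b′ eq = begin
      + a ℤ.- + b                ≡⟨ ℤ.[+m]-[+n]≡m⊖n a b ⟩
      a ℤ.⊖ b                    ≡⟨ ℤ.+-cancelˡ-⊖ b′ a b ⟨
      (b′ ℕ.+ a) ℤ.⊖ (b′ ℕ.+ b)  ≡⟨ ≡.cong₂ ℤ._⊖_ eq′ (ℕ.+-comm b′ b) ⟩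
      (b ℕ.+ a′) ℤ.⊖ (b ℕ.+ b′)  ≡⟨ ℤ.+-cancelˡ-⊖ b a′ b′ ⟩
      a′ ℤ.⊖ b′                  ≡⟨ ℤ.[+m]-[+n]≡m⊖n a′ b′ ⟨
      + a′ ℤ.- + b′              ∎
      where
      open ≡.≡-Reasoning
      eq′ : b′ ℕ.+ a ≡ b ℕ.+ a′
      eq′ = ≡.trans (ℕ.+-comm b′ a) (≡.trans eq (ℕ.+-comm a′ b))

    value-/ : ∀ {r s a b x} → ¬ (r R.≈ R.0#) → ¬ (s R.≈ R.0#) →
              IsExponent R 𝔪 r a → IsExponent R 𝔪 s b →
              x K.* ι s K.≈ ι r → adicValuation x ≡ of-add (ℤ.- (+ a ℤ.- + b))
    value-/ {r} {s} {a} {b} {x} r≉0 s≉0 ea eb eq with fraction x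
    ... | r′ , s′ , s′≉0 , eq′ with ≈0? r′
    ...   | yes r′≈0 = ⊥-elim (r≉0 (injective (K.trans (K.sym eq)
              (K.trans (K.*-congʳ (numerator≈0 eq′ s′≉0 r′≈0)) (K.trans (K.zeroˡ _) (K.sym 0#-homo))))))
    ...   | no r′≉0 = ≡.cong (λ i → of-add (ℤ.- i)) (difference (exponent r′≉0) (exponent s′≉0) a b
              (Assoc-unique
                (Assoc-* (exponent⇒Assoc (exponent-isExponent r′≉0)) (exponent⇒Assoc eb))
                (Assoc-resp (cross eq eq′)
                  (Assoc-* (exponent⇒Assoc ea) (exponent⇒Assoc (exponent-isExponent s′≉0))))))

    value-cong : ∀ {x y} → x K.≈ y → adicValuation x ≡ adicValuation y
    value-cong {x} {y} x≈y = helper (fraction x)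
      where
      helper : (∃₂ λ r s → ¬ (s R.≈ R.0#) × x K.* ι s K.≈ ι r) → adicValuation x ≡ adicValuation y
      helper (r , s , s≉0 , eq) with ≈0? r
      ... | yes r≈0 = ≡.trans (≈0⇒0 x≈0) (≡.sym (≈0⇒0 (K.trans (K.sym x≈y) x≈0)))
        where
        x≈0 : x K.≈ K.0#
        x≈0 = numerator≈0 eq s≉0 r≈0
      ... | no r≉0 = ≡.trans
              (value-/ r≉0 s≉0 (exponent-isExponent r≉0) (exponent-isExponent s≉0) eq)
              (≡.sym (value-/ r≉0 s≉0 (exponent-isExponent r≉0) (exponent-isExponent s≉0)
                (K.trans (K.*-congʳ (K.sym x≈y)) eq)))

  adicValuation-isAdic : IsAdicValuation R F 𝔪 adicValuation
  adicValuation-isAdic = record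
    { cong  = value-cong
    ; map-0 = ≈0⇒0 K.refl
    ; map-/ = value-/
    }

{-# OPTIONS --safe #-}
module Submission where

-- Every nonzero element of R is associate to a unique power of a generator p
-- of 𝔪, so v (r / s) = of-add (b - a) when r ~ pᵃ and s ~ pᵇ.  Multiplicativity
-- is addition of exponents.  Divisibility in R is total: over a common
-- denominator, one numerator divides the other, hence also their sum, and v
-- reverses divisibility of numerators; this is the ultrametric inequality.
-- The fractions pᵃ / pᵇ reach every value.

open import Algebra.Bundles using (CommutativeRing)
import Algebra.Construct.NaturalChoice.Max as NaturalMax
open import Algebra.Morphism.Structures using (module RingMorphisms)
import Algebra.Properties.CommutativeSemigroup as CommSemigroupProps
import Algebra.Properties.Monoid.Divisibility as MonoidDivisibility
import Algebra.Properties.Semiring.Exp as Exp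
open import Data.Integer.Base as ℤ using (+_; -[1+_]; _⊖_)
import Data.Integer.Properties as ℤ
open import Data.Integer.Tactic.RingSolver using (solve-∀)
open import Data.Nat.Base as ℕ using (ℕ; zero; suc)
import Data.Nat.Properties as ℕ
open import Data.Product.Base using (∃; ∃₂; _×_; _,_; proj₂)
open import Data.Sum.Base using (_⊎_; inj₁; inj₂; map)
open import Function.Definitions using (Surjective)
open import Level using (Level; _⊔_)
open import Relation.Binary.Bundles using (TotalOrder)
open import Relation.Binary.Construct.Add.Infimum.NonStrict ℤ._≤_ using (⊥₋≤_; [_])
open import Relation.Binary.PropositionalEquality as ≡ using (_≡_)
import Relation.Binary.Reasoning.Setoid as SetoidReasoning
open import Relation.Nullary using (¬_; yes; no)
open import Relation.Nullary.Construct.Add.Infimum using (⊥₋; [_])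
open import Defs

-- Arithmetic of `ℤₘ₀` and of differences of exponents

·ₘ-zeroʳ : ∀ i → i ·ₘ 0ₘ ≡ 0ₘ
·ₘ-zeroʳ ⊥₋    = ≡.refl
·ₘ-zeroʳ [ _ ] = ≡.refl

⊖-+-⊖ : ∀ a b a′ b′ → (b ℕ.+ b′) ⊖ (a ℕ.+ a′) ≡ (b ⊖ a) ℤ.+ (b′ ⊖ a′)
⊖-+-⊖ a b a′ b′ = begin
  (b ℕ.+ b′) ⊖ (a ℕ.+ a′)                  ≡⟨ ℤ.[+m]-[+n]≡m⊖n (b ℕ.+ b′) (a ℕ.+ a′) ⟨
  (+ b ℤ.+ + b′) ℤ.- (+ a ℤ.+ + a′)        ≡⟨ interchange (+ a) (+ b) (+ a′) (+ b′) ⟩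
  (+ b ℤ.- + a) ℤ.+ (+ b′ ℤ.- + a′)        ≡⟨ ≡.cong₂ ℤ._+_ (ℤ.[+m]-[+n]≡m⊖n b a) (ℤ.[+m]-[+n]≡m⊖n b′ a′) ⟩
  (b ⊖ a) ℤ.+ (b′ ⊖ a′)                    ∎
  where
  open ≡.≡-Reasoning
  interchange : ∀ i j k l → (j ℤ.+ l) ℤ.- (i ℤ.+ k) ≡ (j ℤ.- i) ℤ.+ (l ℤ.- k)
  interchange = solve-∀

-- The naturals are to be exponents in `pᵃ / pᵇ`, whose value is `b ⊖ a`: nonnegative values come
-- from `1 / pⁿ`, negative ones from positive powers of `p`.
⊖-surjective : ∀ i → ∃₂ λ a b → b ⊖ a ≡ i
⊖-surjective (+ n)    = 0 , n , ≡.refl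
⊖-surjective -[1+ n ] = suc n , 0 , ≡.refl

-- Division in a field

module FieldProperties {c ℓ} (K : CommutativeRing c ℓ) (K-isField : IsField K) where
  open CommutativeRing K
  open IsField K-isField

  *-zero-cancelʳ : ∀ {x y} → ¬ (y ≈ 0#) → x * y ≈ 0# → x ≈ 0#
  *-zero-cancelʳ {x} {y} y≉0 xy≈0 with inverse y≉0
  ... | t , yt≈1 = begin
    x            ≈⟨ *-identityʳ x ⟨
    x * 1#       ≈⟨ *-congˡ yt≈1 ⟨
    x * (y * t)  ≈⟨ *-assoc x y t ⟨
    x * y * t    ≈⟨ *-congʳ xy≈0 ⟩
    0# * t       ≈⟨ zeroˡ t ⟩
    0#           ∎
    where open SetoidReasoning setoid

  quotient : ∀ x {y} → ¬ (y ≈ 0#) → ∃ λ z → z * y ≈ x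
  quotient x {y} y≉0 with inverse y≉0
  ... | t , yt≈1 = x * t ,
    trans (*-assoc x t y) (trans (*-congˡ (trans (*-comm t y) yt≈1)) (*-identityʳ x))

-- Divisibility and exponents in a discrete valuation ring

module DVRProperties {c ℓ} (R : CommutativeRing c ℓ) (D : IsDiscreteValuationRing R) where
  open CommutativeRing R
  open IsDiscreteValuationRing D
  open DVR R D
  open MonoidDivisibility *-monoid using (_∣_; _,_; ∣ʳ-trans; ∣ʳ-refl)
  open Exp semiring using (_^_; ^-homo-*)

  zero-∣ : ∀ {r s} → r ≈ 0# → r ∣ s → s ≈ 0#
  zero-∣ r≈0 (q , qr≈s) = trans (sym qr≈s) (trans (*-congˡ r≈0) (zeroʳ q))

  *-≉0 : ∀ {r s} → ¬ (r ≈ 0#) → ¬ (s ≈ 0#) → ¬ (r * s ≈ 0#)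
  *-≉0 r≉0 s≉0 rs≈0 with noZeroDivisor rs≈0
  ... | inj₁ r≈0 = r≉0 r≈0
  ... | inj₂ s≈0 = s≉0 s≈0

  p^n≉0 : ∀ n → ¬ (p ^ n ≈ 0#)
  p^n≉0 zero    = 1≉0
  p^n≉0 (suc n) = *-≉0 p≉0 (p^n≉0 n)

  Assoc-p^ : ∀ n → Assoc (p ^ n) n
  Assoc-p^ n = ∣ʳ-refl ⇄ ∣ʳ-refl

  Assoc⇒≉0 : ∀ {r n} → Assoc r n → ¬ (r ≈ 0#)
  Assoc⇒≉0 {n = n} (r∣pⁿ ⇄ _) r≈0 = p^n≉0 n (zero-∣ r≈0 r∣pⁿ)

  -- A nonzero `r` has some exponent, which again gives a power of `p` associate to `r`. Uniqueness
  -- of that power identifies the exponent with `n`, so no factorization has to be rebuilt.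
  Assoc⇒exponent : ∀ {r n} → Assoc r n → IsExponent R 𝔪 r n
  Assoc⇒exponent {r} r~pⁿ = ≡.subst (IsExponent R 𝔪 r)
    (Assoc-unique (exponent⇒Assoc (exponent-isExponent r≉0)) r~pⁿ)
    (exponent-isExponent r≉0)
    where
    r≉0 : ¬ (r ≈ 0#)
    r≉0 = Assoc⇒≉0 r~pⁿ

  Assoc-∣⇒≤ : ∀ {r s a b} → Assoc r a → Assoc s b → r ∣ s → a ℕ.≤ b
  Assoc-∣⇒≤ {a = a} {b} (_ ⇄ pᵃ∣r) (s∣pᵇ ⇄ _) r∣s =
    p^-injective a b (∣ʳ-trans pᵃ∣r (∣ʳ-trans r∣s s∣pᵇ))

  ≤⇒p^-∣ : ∀ {a b} → a ℕ.≤ b → p ^ a ∣ p ^ b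
  ≤⇒p^-∣ {a} {b} a≤b = p ^ (b ℕ.∸ a) ,
    trans (sym (^-homo-* p (b ℕ.∸ a) a)) (reflexive (≡.cong (p ^_) (ℕ.m∸n+n≡m a≤b)))

  Assoc-≤⇒∣ : ∀ {r s a b} → Assoc r a → Assoc s b → a ℕ.≤ b → r ∣ s
  Assoc-≤⇒∣ (r∣pᵃ ⇄ _) (_ ⇄ pᵇ∣s) a≤b = ∣ʳ-trans r∣pᵃ (∣ʳ-trans (≤⇒p^-∣ a≤b) pᵇ∣s)

  -- Nonzero elements are compared through their exponents. Zero has none, but everything divides
  -- it, so it is split off first.
  ∣-total : ∀ r s → r ∣ s ⊎ s ∣ r
  ∣-total r s with ≈0? r | ≈0? s
  ... | yes r≈0 | _       = inj₂ (Ideal.resp (principal R s) (sym r≈0) (Ideal.0∈ (principal R s)))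
  ... | no _    | yes s≈0 = inj₁ (Ideal.resp (principal R r) (sym s≈0) (Ideal.0∈ (principal R r)))
  ... | no r≉0  | no s≉0  with decompose r≉0 | decompose s≉0
  ...   | a , r~pᵃ | b , s~pᵇ =
          map (Assoc-≤⇒∣ r~pᵃ s~pᵇ) (Assoc-≤⇒∣ s~pᵇ r~pᵃ) (ℕ.≤-total a b)

-- Valuation axioms and surjectivity

module AdicValuationProperties
  {c ℓ k ℓk} (R : CommutativeRing c ℓ) (D : IsDiscreteValuationRing R)
  (F : FractionField R k ℓk) where

  open FractionField F
  private
    module R = CommutativeRing R
  open CommutativeRing K
  open DVR R D
  open DVRProperties R D
  open FieldProperties K isField
  open MonoidDivisibility R.*-monoid using (_∣_; ∣ʳ-refl)
  open Exp R.semiring using (_^_)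
  open RingMorphisms R.rawRing rawRing using (module IsRingMonomorphism)
  open IsRingMonomorphism isRingMonomorphism
    using (injective; +-homo; *-homo; 0#-homo; ⟦⟧-cong)
  open IsAdicValuation (adicValuation-isAdic R D F) using (cong; map-0; map-/)
  open CommSemigroupProps *-commutativeSemigroup using (interchange)
  open TotalOrder ℤₘ₀-totalOrder using () renaming (trans to ≤ₘ-trans)
  open NaturalMax ℤₘ₀-totalOrder using (x≤x⊔y; x≤y⊔x)

  v : Carrier → ℤₘ₀
  v = adicValuation R D F

  infix 4 _≈_/_

  -- Cleared of denominators, as in `fraction` and `map-/`, so that no inverse has to be chosen.
  _≈_/_ : Carrier → R.Carrier → R.Carrier → Set ℓk
  x ≈ r / s = x * ι s ≈ ι r

  ι-≉0 : ∀ {r} → ¬ (r R.≈ R.0#) → ¬ (ι r ≈ 0#)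
  ι-≉0 r≉0 ιr≈0 = r≉0 (injective (trans ιr≈0 (sym 0#-homo)))

  v-0 : ∀ {x} → x ≈ 0# → v x ≡ 0ₘ
  v-0 x≈0 = ≡.trans (cong x≈0) map-0

  /-≈0 : ∀ {x r s} → ¬ (s R.≈ R.0#) → x ≈ r / s → r R.≈ R.0# → x ≈ 0#
  /-≈0 s≉0 x≈r/s r≈0 =
    *-zero-cancelʳ (ι-≉0 s≉0) (trans x≈r/s (trans (⟦⟧-cong r≈0) 0#-homo))

  -- Any representative of `x` is allowed, not only the one chosen by `fraction`, so each later
  -- argument can pick a convenient one. The sign in `map-/` is absorbed by swapping the arguments
  -- of `⊖`.
  v-/ : ∀ {x r s a b} → Assoc r a → Assoc s b → x ≈ r / s → v x ≡ of-add (b ⊖ a)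
  v-/ {a = a} {b} r~pᵃ s~pᵇ eq = ≡.trans
    (map-/ (Assoc⇒≉0 r~pᵃ) (Assoc⇒≉0 s~pᵇ) (Assoc⇒exponent r~pᵃ) (Assoc⇒exponent s~pᵇ) eq)
    (≡.cong of-add (≡.trans (≡.cong ℤ.-_ (ℤ.[+m]-[+n]≡m⊖n a b)) (≡.sym (ℤ.⊖-swap b a))))

  v-1 : v 1# ≡ 1ₘ
  -- The fraction is `1 / 1`, and `p ^ 0` computes to 1.
  v-1 = v-/ {a = 0} {b = 0} (Assoc-p^ 0) (Assoc-p^ 0) (*-identityˡ (ι R.1#))

  -- Zero is kept apart because a zero numerator has no exponent; otherwise the exponents are stored
  -- in the form that `v-/` consumes.
  data Representation (x : Carrier) : Set (c ⊔ ℓ ⊔ k ⊔ ℓk) where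
    null : x ≈ 0# → Representation x
    frac : ∀ {r s a b} → Assoc r a → Assoc s b → x ≈ r / s → Representation x

  represent : ∀ x → Representation x
  represent x with fraction x
  ... | r , s , s≉0 , x≈r/s with ≈0? r
  ...   | yes r≈0 = null (/-≈0 s≉0 x≈r/s r≈0)
  ...   | no r≉0  = frac (proj₂ (decompose r≉0)) (proj₂ (decompose s≉0)) x≈r/s

  v-* : ∀ x y → v (x * y) ≡ v x ·ₘ v y
  v-* x y with represent x | represent y
  ... | null x≈0 | _ = ≡.trans
        (v-0 (trans (*-congʳ x≈0) (zeroˡ y)))
        (≡.cong (_·ₘ v y) (≡.sym (v-0 x≈0)))
  -- `_·ₘ_` computes on a zero left factor, but on a zero right factor it is stuck at `v x`; hence
  -- `·ₘ-zeroʳ`.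
  ... | frac _ _ _ | null y≈0 = ≡.trans
        (v-0 (trans (*-congˡ y≈0) (zeroʳ x)))
        (≡.sym (≡.trans (≡.cong (v x ·ₘ_) (v-0 y≈0)) (·ₘ-zeroʳ (v x))))
  ... | frac {r} {s} {a} {b} r~pᵃ s~pᵇ x≈r/s | frac {r′} {s′} {a′} {b′} r′~pᵃ′ s′~pᵇ′ y≈r′/s′ = begin
        v (x * y)                             ≡⟨ v-/ (Assoc-* r~pᵃ r′~pᵃ′) (Assoc-* s~pᵇ s′~pᵇ′) xy≈rr′/ss′ ⟩
        of-add ((b ℕ.+ b′) ⊖ (a ℕ.+ a′))      ≡⟨ ≡.cong of-add (⊖-+-⊖ a b a′ b′) ⟩
        of-add (b ⊖ a) ·ₘ of-add (b′ ⊖ a′)    ≡⟨ ≡.cong₂ _·ₘ_ (v-/ r~pᵃ s~pᵇ x≈r/s) (v-/ r′~pᵃ′ s′~pᵇ′ y≈r′/s′) ⟨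
        v x ·ₘ v y                            ∎
        where
        open ≡.≡-Reasoning
        xy≈rr′/ss′ : x * y ≈ r R.* r′ / s R.* s′
        xy≈rr′/ss′ = trans (*-congˡ (*-homo s s′))
          (trans (interchange x y (ι s) (ι s′))
          (trans (*-cong x≈r/s y≈r′/s′) (sym (*-homo r r′))))

  -- With the denominator fixed, `b ⊖ a` falls as the exponent `a` of the numerator grows. If `r` is
  -- zero, the left side is the least element; if not, its divisor `r′` is nonzero too and has an
  -- exponent.
  v-antitone : ∀ {x y r r′ s} → ¬ (s R.≈ R.0#) → x ≈ r / s → y ≈ r′ / s → r′ ∣ r → v x ≤ₘ v y
  v-antitone {x} {y} {r} {r′} s≉0 x≈r/s y≈r′/s r′∣r with ≈0? r
  ... | yes r≈0 = ≡.subst (_≤ₘ v y) (≡.sym (v-0 (/-≈0 s≉0 x≈r/s r≈0))) (⊥₋≤ v y)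
  ... | no r≉0 with decompose r≉0 | decompose (λ r′≈0 → r≉0 (zero-∣ r′≈0 r′∣r)) | decompose s≉0
  ...   | a , r~pᵃ | a′ , r′~pᵃ′ | b , s~pᵇ =
          ≡.subst₂ _≤ₘ_ (≡.sym (v-/ r~pᵃ s~pᵇ x≈r/s)) (≡.sym (v-/ r′~pᵃ′ s~pᵇ y≈r′/s))
            [ ℤ.⊖-monoʳ-≥-≤ b (Assoc-∣⇒≤ r′~pᵃ′ r~pᵃ r′∣r) ]

  commonDenominator : ∀ x y → ∃ λ s → ∃₂ λ r r′ → ¬ (s R.≈ R.0#) × x ≈ r / s × y ≈ r′ / s
  commonDenominator x y with fraction x | fraction y
  ... | r , s , s≉0 , x≈r/s | r′ , s′ , s′≉0 , y≈r′/s′ =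
    s R.* s′ , r R.* s′ , r′ R.* s , *-≉0 s≉0 s′≉0 , expand x≈r/s ,
    -- Expanding `r′ / s′` by `s` gives the denominator `s′ * s`, which is commuted to match the
    -- first fraction.
    trans (*-congˡ (⟦⟧-cong (R.*-comm s s′))) (expand y≈r′/s′)
    where
    expand : ∀ {x r s t} → x ≈ r / s → x ≈ r R.* t / s R.* t
    expand {x} {r} {s} {t} x≈r/s = trans (*-congˡ (*-homo s t))
      (trans (sym (*-assoc x (ι s) (ι t))) (trans (*-congʳ x≈r/s) (sym (*-homo r t))))

  v-+ : ∀ x y → v (x + y) ≤ₘ maxₘ (v x) (v y)
  v-+ x y with commonDenominator x y
  ... | s , r , r′ , s≉0 , x≈r/s , y≈r′/s = bound (∣-total r r′)
    where
    x+y≈ : x + y ≈ r R.+ r′ / s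
    x+y≈ = trans (distribʳ (ι s) x y) (trans (+-cong x≈r/s y≈r′/s) (sym (+-homo r r′)))

    -- The numerator that divides the other belongs to the larger value. It also divides the sum of
    -- the numerators, so that value already bounds `v (x + y)`.
    bound : r ∣ r′ ⊎ r′ ∣ r → v (x + y) ≤ₘ maxₘ (v x) (v y)
    bound (inj₁ r∣r′) = ≤ₘ-trans
      (v-antitone s≉0 x+y≈ x≈r/s (Ideal.+-closed (principal R r) ∣ʳ-refl r∣r′))
      (x≤x⊔y (v x) (v y))
    bound (inj₂ r′∣r) = ≤ₘ-trans
      (v-antitone s≉0 x+y≈ y≈r′/s (Ideal.+-closed (principal R r′) r′∣r ∣ʳ-refl))
      (x≤y⊔x (v x) (v y))

  v-surjective : Surjective _≈_ _≡_ v
  -- `Surjective` asks for the value at every element equal to the witness, which is why `v-0` fits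
  -- here and `cong z≈x` appears below.
  v-surjective ⊥₋    = 0# , v-0
  v-surjective [ i ] with ⊖-surjective i
  ... | a , b , b⊖a≡i with quotient (ι (p ^ a)) (ι-≉0 (p^n≉0 b))
  ...   | x , x≈pᵃ/pᵇ = x , λ z≈x → ≡.trans (cong z≈x)
          (≡.trans (v-/ (Assoc-p^ a) (Assoc-p^ b) x≈pᵃ/pᵇ) (≡.cong of-add b⊖a≡i))

  v-isDiscrete : IsDiscreteValuation K v
  v-isDiscrete = record
    { isValuation = record
      { cong  = cong
      ; map-0 = map-0
      ; map-1 = v-1
      ; map-* = v-*
      ; map-+ = v-+
      }
    ; surjective  = v-surjective
    }

mainTheorem2 : ∀ {c ℓ k ℓk : Level} (R : CommutativeRing c ℓ) (D : IsDiscreteValuationRing R)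
    (F : FractionField R k ℓk) →
    IsDiscreteValuation (FractionField.K F) (adicValuation R D F)
mainTheorem2 = AdicValuationProperties.v-isDiscrete
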